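{- For all integers $n,m\geq 3$, $s_5(P_n\square P_m)=4$.
   Context: $P_k$ denotes the path on $k$ vertices, and $\square$ denotes the Cartesian product of graphs. A $P_k$-coloring of a graph $G$ is a proper vertex coloring of $G$ in which no copy of $P_k$ in $G$ (as a subgraph, not necessarily induced) is bicolored, i.e. has its vertices colored using only two colors. The $P_k$-chromatic number $s_k(G)$ is the minimum number of colors in a $P_k$-coloring of $G$. -}

module Defs where

open import Data.Fin.Base using (Fin; toℕ)
open import Data.Nat.Base using (ℕ; suc; _≤_)
open import Data.Nat.Properties using (1+n≢n)
open import Data.Product.Base using (Σ-syntax; ∃-syntax; _×_; _,_)
open import Data.Sum.Base using (_⊎_; inj₁; inj₂; swap)
open import Function.Definitions using (Injective)
open import Level using (0ℓ)
open import Relation.Binary.Core using (Rel; _Preserves_⟶_)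
open import Relation.Binary.Definitions using (Symmetric; Irreflexive)
open import Relation.Binary.PropositionalEquality using (_≡_; _≢_; refl; sym)
open import Relation.Nullary.Negation using (¬_)

record Graph : Set₁ where
  field
    Vertex : Set
    Adj    : Rel Vertex 0ℓ
    symm   : Symmetric Adj
    irrefl : Irreflexive _≡_ Adj

open Graph public

-- P k has k vertices, hence k - 1 edges.
P : ℕ → Graph
P k .Vertex    = Fin k
P k .Adj i j   = suc (toℕ i) ≡ toℕ j ⊎ suc (toℕ j) ≡ toℕ i
P k .symm      = swap
P k .irrefl refl (inj₁ e) = 1+n≢n e
P k .irrefl refl (inj₂ e) = 1+n≢n e

infixr 7 _□_

_□_ : Graph → Graph → Graph
(G □ H) .Vertex = Vertex G × Vertex H
(G □ H) .Adj (u , v) (u′ , v′) = (u ≡ u′ × Adj H v v′) ⊎ (Adj G u u′ × v ≡ v′)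
(G □ H) .symm (inj₁ (e , a)) = inj₁ (sym e , symm H a)
(G □ H) .symm (inj₂ (a , e)) = inj₂ (symm G a , sym e)
(G □ H) .irrefl refl (inj₁ (_ , a)) = irrefl H refl a
(G □ H) .irrefl refl (inj₂ (a , _)) = irrefl G refl a

-- A not necessarily induced copy of H in G: non-edges of H are unconstrained.
record Copy (H G : Graph) : Set where
  field
    embed     : Vertex H → Vertex G
    injective : Injective _≡_ _≡_ embed
    preserves : embed Preserves Adj H ⟶ Adj G

open Copy public

Coloring : Graph → ℕ → Set
Coloring G q = Vertex G → Fin q

Proper : (G : Graph) {q : ℕ} → Coloring G q → Set
Proper G c = ∀ {u v} → Adj G u v → c u ≢ c v

Bicolored : {H G : Graph} {q : ℕ} → Coloring G q → Copy H G → Set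
Bicolored c p = ∃[ a ] ∃[ b ] ∀ x → c (embed p x) ≡ a ⊎ c (embed p x) ≡ b

IsPathColoring : (k : ℕ) (G : Graph) {q : ℕ} → Coloring G q → Set
IsPathColoring k G c = Proper G c × ((p : Copy (P k) G) → ¬ Bicolored c p)

PathColorable : (k : ℕ) → Graph → ℕ → Set
PathColorable k G q = Σ[ c ∈ Coloring G q ] IsPathColoring k G c

-- s[ k ] G ≐ q says that s_k(G) = q.  The chromatic number is a relation rather
-- than a function because for an arbitrary Graph (possibly infinite) the least
-- number of colors need not exist or be computable; it is unique when it exists.
infix 4 s[_]_≐_

s[_]_≐_ : ℕ → Graph → ℕ → Set
s[ k ] G ≐ q = PathColorable k G q × (∀ r → PathColorable k G r → q ≤ r)

{-# OPTIONS --safe #-}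

-- Upper bound: colour (i , j) by the parities of i + j and of ⌊i/2⌋ + ⌊j/2⌋.
-- An edge either preserves ⌊i/2⌋ and ⌊j/2⌋, and then the second parity, or
-- preserves ⌈i/2⌉ and ⌈j/2⌉ and flips the second parity.  Whether the second
-- parity flips along an edge depends only on the pair of colours at its ends,
-- so a bicolored path stays inside one 2 × 2 block of one of these two kinds,
-- and five vertices do not fit there.
--
-- Lower bound: P 3 □ P 3 embeds in P n □ P m, and each of its proper
-- 3-colorings makes one of eight copies of P 5 bicolored.
module Submission where

open import Defs
open import Data.Fin.Base using (Fin; toℕ; inject₁; inject≤; combine; opposite)
open import Data.Fin.Induction using (<-weakInduction)
open import Data.Fin.Patterns using (0F; 1F; 2F)
open import Data.Fin.Properties
  using (_≟_; all?; combine-injective; inject≤-injective; opposite-involutive;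
         pigeonhole; toℕ-inject₁; toℕ-inject≤; toℕ-injective)
import Data.Fin.Properties as Fin
open import Data.List.Base using (List; []; _∷_)
open import Data.List.Relation.Unary.All as All using (All)
open import Data.List.Relation.Unary.Any as Any using (Any)
open import Data.Nat.Base using (ℕ; zero; suc; _+_; _≤_; s≤s⁻¹; ⌊_/2⌋; ⌈_/2⌉)
open import Data.Nat.Properties as ℕ using (+-suc; suc-injective; ≤-refl; ≮⇒≥)
open import Data.Product.Base using (_×_; _,_; proj₁; proj₂; map)
open import Data.Product.Properties using (≡-dec; ×-≡,≡→≡; ,-injective)
open import Data.Sum.Base as Sum using (_⊎_; inj₁; inj₂; [_,_]′)
open import Data.Vec.Base using (Vec; []; _∷_; lookup; tabulate)
open import Data.Vec.Properties using (lookup∘tabulate)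
open import Function.Base using (_∘_; _$_; id)
open import Function.Definitions using (Injective)
open import Relation.Binary.PropositionalEquality
  using (_≡_; _≢_; _≗_; refl; sym; trans; cong; cong₂)
open import Relation.Nullary.Decidable
  using (Dec; yes; no; map′; from-yes; ¬?; _×-dec_; _⊎-dec_; _→-dec_)
open import Relation.Nullary.Negation using (¬_; contradiction)
open import Relation.Unary using (Decidable)

private variable
  k l q r : ℕ
  F G H : Graph

_∘ᶜ_ : Copy G H → Copy F G → Copy F H
(ψ ∘ᶜ φ) .embed     = embed ψ ∘ embed φ
(ψ ∘ᶜ φ) .injective = injective φ ∘ injective ψ
(ψ ∘ᶜ φ) .preserves = preserves ψ ∘ preserves φ

□-copy : ∀ {F′ G′} → Copy F G → Copy F′ G′ → Copy (F □ F′) (G □ G′)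
□-copy φ ψ .embed = map (embed φ) (embed ψ)
□-copy φ ψ .injective e with ,-injective e
... | e₁ , e₂ = ×-≡,≡→≡ (injective φ e₁ , injective ψ e₂)
□-copy φ ψ .preserves (inj₁ (e , a)) = inj₁ (cong (embed φ) e , preserves ψ a)
□-copy φ ψ .preserves (inj₂ (a , e)) = inj₂ (preserves φ a , cong (embed ψ) e)

P-copy : k ≤ l → Copy (P k) (P l)
P-copy k≤l .embed i     = inject≤ i k≤l
P-copy k≤l .injective   = inject≤-injective k≤l k≤l _ _
P-copy k≤l .preserves {i} {j} a
  rewrite toℕ-inject≤ i k≤l | toℕ-inject≤ j k≤l = a

-- A bicolored path of `G` would give one of `H`, because `φ ∘ᶜ p` passes through the same colors.
PathColorable-restrict : Copy G H → PathColorable k H q → PathColorable k G q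
PathColorable-restrict φ (c , proper , good) =
  c ∘ embed φ , proper ∘ preserves φ , λ p → good (φ ∘ᶜ p)

-- Lower bound: a finite check on the 3 × 3 grid.

all-Vec? : ∀ {n} {Q : Vec (Fin k) n → Set} → Decidable Q → Dec (∀ v → Q v)
all-Vec? {n = zero}  Q? = map′ (λ { q [] → q }) (_$ []) (Q? [])
all-Vec? {n = suc n} Q? =
  map′ (λ { f (x ∷ v) → f x v }) (λ f x v → f (x ∷ v))
       (all? λ x → all-Vec? λ v → Q? (x ∷ v))

Grid : ℕ → ℕ → Graph
Grid n m = P n □ P m

Adj-P? : (i j : Fin k) → Dec (Adj (P k) i j)
Adj-P? i j = suc (toℕ i) ℕ.≟ toℕ j ⊎-dec suc (toℕ j) ℕ.≟ toℕ i

Adj-Grid? : ∀ {n m} (u v : Vertex (Grid n m)) → Dec (Adj (Grid n m) u v)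
Adj-Grid? (i , j) (i′ , j′) =
  (i ≟ i′ ×-dec Adj-P? j j′) ⊎-dec (Adj-P? i i′ ×-dec j ≟ j′)

-- The explicit quantifiers make this decidable, unlike Copy (P k) (Grid n m).
IsPath : ∀ {n m} → Vec (Vertex (Grid n m)) k → Set
IsPath {k} {n} {m} p =
  (∀ x y → lookup p x ≡ lookup p y → x ≡ y) ×
  (∀ x y → Adj (P k) x y → Adj (Grid n m) (lookup p x) (lookup p y))

IsPath? : ∀ {n m} → Decidable (IsPath {k} {n} {m})
IsPath? p =
  (all? λ x → all? λ y → ≡-dec _≟_ _≟_ (lookup p x) (lookup p y) →-dec x ≟ y) ×-dec
  (all? λ x → all? λ y → Adj-P? x y →-dec Adj-Grid? (lookup p x) (lookup p y))

toCopy : ∀ {n m} {p : Vec (Vertex (Grid n m)) k} → IsPath p → Copy (P k) (Grid n m)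
toCopy {p = p} _ .embed     = lookup p
toCopy (inj , _) .injective = inj _ _
toCopy (_ , adj) .preserves = adj _ _

-- Properness separates the first two vertices of a path, so their colors are the only candidates
-- for the two colors of a bicolored path. Naming them spares a search over pairs of colors.
TwoColored : {A : Set} → (A → Fin q) → Vec A (suc (suc k)) → Set
TwoColored c p =
  ∀ x → c (lookup p x) ≡ c (lookup p 0F) ⊎ c (lookup p x) ≡ c (lookup p 1F)

TwoColored? : {A : Set} (c : A → Fin q) → Decidable (TwoColored {k = k} c)
TwoColored? c p =
  all? λ x → c (lookup p x) ≟ c (lookup p 0F) ⊎-dec c (lookup p x) ≟ c (lookup p 1F)

-- The search runs over vectors, and tabulating a coloring gives it back only up to pointwise
-- equality.
TwoColored-cong : {A : Set} {c d : A → Fin q} → c ≗ d →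
                  ∀ {p : Vec A (suc (suc k))} → TwoColored c p → TwoColored d p
TwoColored-cong {c = c} {d} c≗d {p} t x =
  Sum.map (transport x 0F) (transport x 1F) (t x)
  where
  transport : ∀ x y → c (lookup p x) ≡ c (lookup p y) → d (lookup p x) ≡ d (lookup p y)
  transport _ _ e = trans (sym (c≗d _)) (trans e (c≗d _))

-- Found by computer (greedy set cover over the 246 proper 3-colorings).
paths : List (Vec (Fin 3 × Fin 3) 5)
paths =
  ((0F , 0F) ∷ (0F , 1F) ∷ (1F , 1F) ∷ (1F , 2F) ∷ (2F , 2F) ∷ []) ∷
  ((0F , 2F) ∷ (0F , 1F) ∷ (1F , 1F) ∷ (1F , 0F) ∷ (2F , 0F) ∷ []) ∷
  ((0F , 0F) ∷ (0F , 1F) ∷ (1F , 1F) ∷ (2F , 1F) ∷ (2F , 0F) ∷ []) ∷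
  ((0F , 2F) ∷ (0F , 1F) ∷ (1F , 1F) ∷ (2F , 1F) ∷ (2F , 2F) ∷ []) ∷
  ((0F , 0F) ∷ (1F , 0F) ∷ (1F , 1F) ∷ (1F , 2F) ∷ (0F , 2F) ∷ []) ∷
  ((1F , 0F) ∷ (0F , 0F) ∷ (0F , 1F) ∷ (0F , 2F) ∷ (1F , 2F) ∷ []) ∷
  ((0F , 1F) ∷ (0F , 0F) ∷ (1F , 0F) ∷ (2F , 0F) ∷ (2F , 1F) ∷ []) ∷
  ((1F , 0F) ∷ (2F , 0F) ∷ (2F , 1F) ∷ (2F , 2F) ∷ (1F , 2F) ∷ []) ∷ []

paths-IsPath : All IsPath paths
paths-IsPath = from-yes (All.all? IsPath? paths)

ProperRow : Vec (Fin q) 3 → Set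
ProperRow r = lookup r 0F ≢ lookup r 1F × lookup r 1F ≢ lookup r 2F

ProperRow? : Decidable (ProperRow {q})
ProperRow? r = ¬? (_ ≟ _) ×-dec ¬? (_ ≟ _)

Apart : Vec (Fin q) k → Vec (Fin q) k → Set
Apart r s = ∀ i → lookup r i ≢ lookup s i

Apart? : (r s : Vec (Fin q) k) → Dec (Apart r s)
Apart? r s = all? λ i → ¬? (lookup r i ≟ lookup s i)

colorBy : Vec (Vec (Fin q) l) k → Fin k × Fin l → Fin q
colorBy rows (i , j) = lookup (lookup rows i) j

-- Interleaving the properness hypotheses prunes the search from 3⁹ colorings
-- to the 246 proper ones.
rows-TwoColored :
  ∀ (r : Vec (Fin 3) 3) → ProperRow r →
  ∀ (s : Vec (Fin 3) 3) → ProperRow s → Apart r s →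
  ∀ (t : Vec (Fin 3) 3) → ProperRow t → Apart s t →
  Any (TwoColored (colorBy (r ∷ s ∷ t ∷ []))) paths
rows-TwoColored = from-yes
  (all-Vec? λ (r : Vec (Fin 3) 3) → ProperRow? r →-dec
  (all-Vec? λ (s : Vec (Fin 3) 3) → ProperRow? s →-dec Apart? r s →-dec
  (all-Vec? λ (t : Vec (Fin 3) 3) → ProperRow? t →-dec Apart? s t →-dec
  Any.any? (TwoColored? (colorBy (r ∷ s ∷ t ∷ []))) paths)))

paths-TwoColored : (c : Coloring (Grid 3 3) 3) → Proper (Grid 3 3) c →
                   Any (TwoColored c) paths
paths-TwoColored c proper =
  Any.map (λ {p} → TwoColored-cong colorBy-rows {p})
    (rows-TwoColored (row 0F) (row-proper 0F)
                     (row 1F) (row-proper 1F) (rows-apart 0F 1F (inj₁ refl))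
                     (row 2F) (row-proper 2F) (rows-apart 1F 2F (inj₁ refl)))
  where
  row : Fin 3 → Vec (Fin 3) 3
  row i = tabulate λ j → c (i , j)

  row-proper : ∀ i → ProperRow (row i)
  row-proper i = proper (inj₁ (refl , inj₁ refl)) , proper (inj₁ (refl , inj₁ refl))

  rows-apart : ∀ i i′ → Adj (P 3) i i′ → Apart (row i) (row i′)
  rows-apart i i′ a j
    -- Lookup is stuck at the variable index `j`, whereas it computes at the closed indices of
    -- `row-proper`.
    rewrite lookup∘tabulate (λ j → c (i , j)) j | lookup∘tabulate (λ j → c (i′ , j)) j
    = proper (inj₂ (a , refl))

  colorBy-rows : colorBy (tabulate row) ≗ c
  colorBy-rows (i , j)
    rewrite lookup∘tabulate row i = lookup∘tabulate (λ j → c (i , j)) j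

-- Widening the palette to `Fin 3` lets one search cover every `r ≤ 3`. Injectivity of `widen`
-- carries properness forward and equalities of colors back.
¬PathColorable-Grid₃₃ : r ≤ 3 → ¬ PathColorable 5 (Grid 3 3) r
¬PathColorable-Grid₃₃ {r} r≤3 (c , proper , good) =
  All.lookupWith
    (λ {p} path t → good (toCopy {p = p} path) (_ , _ , Sum.map widen-injective widen-injective ∘ t))
    paths-IsPath
    (paths-TwoColored (widen ∘ c) (λ a → proper a ∘ widen-injective))
  where
  widen : Fin r → Fin 3
  widen i = inject≤ i r≤3
  widen-injective : Injective _≡_ _≡_ widen
  widen-injective = inject≤-injective r≤3 r≤3 _ _

-- Parities and halves of natural numbers.

bit : ℕ → Fin 2
bit zero    = 0F
bit (suc n) = opposite (bit n)

infix 4 _~_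

_~_ : ℕ → ℕ → Set
i ~ j = suc i ≡ j ⊎ suc j ≡ i

~-+ʳ : ∀ {i j} k → i ~ j → i + k ~ j + k
~-+ʳ k = Sum.map (cong (_+ k)) (cong (_+ k))

~-+ˡ : ∀ {i j} k → i ~ j → k + i ~ k + j
~-+ˡ {i} {j} k = Sum.map (λ e → trans (sym (+-suc k i)) (cong (k +_) e))
                         (λ e → trans (sym (+-suc k j)) (cong (k +_) e))

opposite-≢ : (b : Fin 2) → opposite b ≢ b
opposite-≢ 0F ()
opposite-≢ 1F ()

bit-~ : ∀ {i j} → i ~ j → bit i ≢ bit j
bit-~ {i} (inj₁ refl) = opposite-≢ (bit i) ∘ sym
bit-~ {j = j} (inj₂ refl) = opposite-≢ (bit j)

⌈n/2⌉≡⌊n/2⌋⊎1+⌊n/2⌋ : ∀ n → ⌈ n /2⌉ ≡ ⌊ n /2⌋ ⊎ ⌈ n /2⌉ ≡ suc ⌊ n /2⌋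
⌈n/2⌉≡⌊n/2⌋⊎1+⌊n/2⌋ 0             = inj₁ refl
⌈n/2⌉≡⌊n/2⌋⊎1+⌊n/2⌋ 1             = inj₂ refl
⌈n/2⌉≡⌊n/2⌋⊎1+⌊n/2⌋ (suc (suc n)) = Sum.map (cong suc) (cong suc) (⌈n/2⌉≡⌊n/2⌋⊎1+⌊n/2⌋ n)

-- Neighbours form either a pair 2t, 2t+1, with a common floor, or a pair 2t-1, 2t, with a common
-- ceiling.
half-~ : ∀ {i j} → i ~ j →
         ⌊ i /2⌋ ≡ ⌊ j /2⌋ ⊎ (⌈ i /2⌉ ≡ ⌈ j /2⌉ × ⌊ i /2⌋ ~ ⌊ j /2⌋)
half-~ {i} (inj₁ refl) =
  -- By computation `⌊ suc i /2⌋` is `⌈ i /2⌉` and `⌈ suc i /2⌉` is `suc ⌊ i /2⌋`.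
  Sum.map sym (λ e → e , inj₁ (sym e)) (⌈n/2⌉≡⌊n/2⌋⊎1+⌊n/2⌋ i)
half-~ {j = j} (inj₂ refl) =
  Sum.map id (λ e → sym e , inj₂ (sym e)) (⌈n/2⌉≡⌊n/2⌋⊎1+⌊n/2⌋ j)

-- Halving loses exactly the last binary digit, which `bit` restores.
⌊/2⌋-bit-injective : ∀ i j → ⌊ i /2⌋ ≡ ⌊ j /2⌋ → bit i ≡ bit j → i ≡ j
⌊/2⌋-bit-injective 0 0 _ _ = refl
⌊/2⌋-bit-injective 0 1 _ ()
⌊/2⌋-bit-injective 1 0 _ ()
⌊/2⌋-bit-injective 1 1 _ _ = refl
⌊/2⌋-bit-injective 0 (suc (suc _)) ()
⌊/2⌋-bit-injective 1 (suc (suc _)) ()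
⌊/2⌋-bit-injective (suc (suc i)) (suc (suc j)) e b =
  cong (suc ∘ suc) (⌊/2⌋-bit-injective i j (suc-injective e)
    (trans (sym (opposite-involutive (bit i)))
           (trans b (opposite-involutive (bit j)))))

⌈/2⌉-bit-injective : ∀ i j → ⌈ i /2⌉ ≡ ⌈ j /2⌉ → bit i ≡ bit j → i ≡ j
⌈/2⌉-bit-injective i j e b =
  -- The ceiling of a half is the floor for the successor, whose bit is flipped.
  suc-injective (⌊/2⌋-bit-injective (suc i) (suc j) e (cong opposite b))

P-connected : {A : Set} (g : Fin (suc k) → A) →
              (∀ {x y} → Adj (P (suc k)) x y → g x ≡ g y) → ∀ x → g x ≡ g 0F
P-connected g step =
  <-weakInduction (λ x → g x ≡ g 0F) refl λ i e →
    trans (sym (step (inj₁ (cong suc (toℕ-inject₁ i))))) e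

-- Both pairs list the same two elements `a` and `b`, so they agree up to order.
pairs-from-two : {A : Set} {a b x y z w : A} →
                 x ≡ a ⊎ x ≡ b → y ≡ a ⊎ y ≡ b → z ≡ a ⊎ z ≡ b → w ≡ a ⊎ w ≡ b →
                 x ≢ y → z ≢ w → (x ≡ z × y ≡ w) ⊎ (x ≡ w × y ≡ z)
pairs-from-two (inj₁ refl) (inj₁ refl) _ _ x≢y _ = contradiction refl x≢y
pairs-from-two (inj₂ refl) (inj₂ refl) _ _ x≢y _ = contradiction refl x≢y
pairs-from-two _ _ (inj₁ refl) (inj₁ refl) _ z≢w = contradiction refl z≢w
pairs-from-two _ _ (inj₂ refl) (inj₂ refl) _ z≢w = contradiction refl z≢w
pairs-from-two (inj₁ refl) (inj₂ refl) (inj₁ refl) (inj₂ refl) _ _ = inj₁ (refl , refl)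
pairs-from-two (inj₁ refl) (inj₂ refl) (inj₂ refl) (inj₁ refl) _ _ = inj₂ (refl , refl)
pairs-from-two (inj₂ refl) (inj₁ refl) (inj₁ refl) (inj₂ refl) _ _ = inj₂ (refl , refl)
pairs-from-two (inj₂ refl) (inj₁ refl) (inj₂ refl) (inj₁ refl) _ _ = inj₁ (refl , refl)

-- Upper bound: the 4-coloring of the grid.

module _ {n m : ℕ} where

  floors ceilings : Vertex (Grid n m) → ℕ × ℕ
  floors   (i , j) = ⌊ toℕ i /2⌋ , ⌊ toℕ j /2⌋
  ceilings (i , j) = ⌈ toℕ i /2⌉ , ⌈ toℕ j /2⌉

  parity blockParity : Vertex (Grid n m) → Fin 2
  parity      (i , j) = bit (toℕ i + toℕ j)
  blockParity (i , j) = bit (⌊ toℕ i /2⌋ + ⌊ toℕ j /2⌋)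

  coloring : Coloring (Grid n m) 4
  coloring v = combine (parity v) (blockParity v)

  coloring-proper : Proper (Grid n m) coloring
  coloring-proper {u} {v} a e =
    parity-≢ a (proj₁ (combine-injective (parity u) (blockParity u) (parity v) (blockParity v) e))
    where
    parity-≢ : ∀ {u v} → Adj (Grid n m) u v → parity u ≢ parity v
    parity-≢ {i , _} (inj₁ (refl , a)) = bit-~ (~-+ˡ (toℕ i) a)
    parity-≢ {_ , j} (inj₂ (a , refl)) = bit-~ (~-+ʳ (toℕ j) a)

  -- Only one coordinate moves. If its floor changes, it changes by one, which flips the parity of
  -- the sum of the floors.
  step : ∀ {u v} → Adj (Grid n m) u v →
         floors u ≡ floors v ⊎ (ceilings u ≡ ceilings v × blockParity u ≢ blockParity v)
  step {i , _} (inj₁ (refl , a)) =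
    Sum.map (cong (_ ,_)) (map (cong (_ ,_)) (bit-~ ∘ ~-+ˡ ⌊ toℕ i /2⌋)) (half-~ a)
  step {_ , j} (inj₂ (a , refl)) =
    Sum.map (cong (_, _)) (map (cong (_, _)) (bit-~ ∘ ~-+ʳ ⌊ toℕ j /2⌋)) (half-~ a)

  floors-step : ∀ {u v} → Adj (Grid n m) u v → blockParity u ≡ blockParity v →
                floors u ≡ floors v
  floors-step a e with step a
  ... | inj₁ same     = same
  ... | inj₂ (_ , ne) = contradiction e ne

  ceilings-step : ∀ {u v} → Adj (Grid n m) u v → blockParity u ≢ blockParity v →
                  ceilings u ≡ ceilings v
  ceilings-step a ne with step a
  ... | inj₁ same       = contradiction (cong (λ (x , y) → bit (x + y)) same) ne
  ... | inj₂ (same , _) = same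

  bits : Vertex (Grid n m) → Fin 4
  bits (i , j) = combine (bit (toℕ i)) (bit (toℕ j))

  -- Makes each fibre of `K` a block of at most four vertices, told apart by `bits`. Floors and
  -- ceilings both qualify and share the pigeonhole argument.
  BlockMap : (Vertex (Grid n m) → ℕ × ℕ) → Set
  BlockMap K = ∀ {u v} → K u ≡ K v → bits u ≡ bits v → u ≡ v

  blockMap : (half : ℕ → ℕ) → (∀ i j → half i ≡ half j → bit i ≡ bit j → i ≡ j) →
             BlockMap (λ (i , j) → half (toℕ i) , half (toℕ j))
  blockMap half inj {i , j} {i′ , j′} e b
    with ,-injective e
       | combine-injective (bit (toℕ i)) (bit (toℕ j)) (bit (toℕ i′)) (bit (toℕ j′)) b
  ... | e₁ , e₂ | b₁ , b₂ =
    cong₂ _,_ (toℕ-injective (inj _ _ e₁ b₁)) (toℕ-injective (inj _ _ e₂ b₂))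

  ¬P₅-in-block : ∀ {K} → BlockMap K → (p : Copy (P 5) (Grid n m)) →
                 ¬ (∀ {x y} → Adj (P 5) x y → K (embed p x) ≡ K (embed p y))
  ¬P₅-in-block {K} block p constant
    -- Here `≤-refl` proves `4 < 5`: five vertices share four values of `bits`.
    with x , y , x<y , e ← pigeonhole ≤-refl (bits ∘ embed p)
    = Fin.<⇒≢ x<y (injective p (block (trans (const x) (sym (const y))) e))
    where const = P-connected (K ∘ embed p) constant

  color-blockParity : ∀ u v → coloring u ≡ coloring v → blockParity u ≡ blockParity v
  color-blockParity u v e =
    proj₂ (combine-injective (parity u) (blockParity u) (parity v) (blockParity v) e)

  -- Up to order, every edge of a bicolored path has the colours of its first edge.
  edge-blockParity :
    (p : Copy (P 5) (Grid n m)) → Bicolored coloring p → let β = blockParity ∘ embed p in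
    ∀ {x y} → Adj (P 5) x y → (β x ≡ β 0F × β y ≡ β 1F) ⊎ (β x ≡ β 1F × β y ≡ β 0F)
  edge-blockParity p (_ , _ , ab) {x} {y} a =
    Sum.map (map (same x 0F) (same y 1F)) (map (same x 1F) (same y 0F))
      (pairs-from-two (ab x) (ab y) (ab 0F) (ab 1F) (differ a) (differ {0F} {1F} (inj₁ refl)))
    where
    same : ∀ s t → coloring (embed p s) ≡ coloring (embed p t) →
           blockParity (embed p s) ≡ blockParity (embed p t)
    same s t = color-blockParity (embed p s) (embed p t)

    differ : ∀ {s t} → Adj (P 5) s t → coloring (embed p s) ≢ coloring (embed p t)
    differ b = coloring-proper (preserves p b)

  coloring-¬bicolored : (p : Copy (P 5) (Grid n m)) → ¬ Bicolored coloring p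
  coloring-¬bicolored p bi with blockParity (embed p 0F) ≟ blockParity (embed p 1F)
  -- The first edge keeps the block parity, hence every edge does, and the floors stay constant.
  ... | yes β₀≡β₁ = ¬P₅-in-block (blockMap ⌊_/2⌋ ⌊/2⌋-bit-injective) p λ a →
    floors-step (preserves p a)
      ([ (λ (e , e′) → trans e (trans β₀≡β₁ (sym e′)))
       , (λ (e , e′) → trans e (trans (sym β₀≡β₁) (sym e′))) ]′ (edge-blockParity p bi a))
  -- Now every edge flips the block parity, and the ceilings stay constant.
  ... | no β₀≢β₁ = ¬P₅-in-block (blockMap ⌈_/2⌉ ⌈/2⌉-bit-injective) p λ a →
    ceilings-step (preserves p a) λ e →
      β₀≢β₁ ([ (λ (e₁ , e₂) → trans (sym e₁) (trans e e₂))
             , (λ (e₁ , e₂) → trans (sym e₂) (trans (sym e) e₁)) ]′ (edge-blockParity p bi a))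

theorem8 : ∀ (n m : ℕ) → 3 ≤ n → 3 ≤ m → s[ 5 ] (P n □ P m) ≐ 4
theorem8 n m 3≤n 3≤m =
  (coloring , coloring-proper , coloring-¬bicolored) ,
  λ r colorable → ≮⇒≥ λ r<4 →
    -- At most three colors on the large grid would restrict to its 3 × 3 corner.
    ¬PathColorable-Grid₃₃ (s≤s⁻¹ r<4)
      (PathColorable-restrict (□-copy (P-copy 3≤n) (P-copy 3≤m)) colorable)
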